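{- For all sufficiently large $k$, every deterministic $k$-way branching program that solves $BT^3_2(k)$ has at least $k^3/\log k$ states.
   Context: $T^3_2$ is the balanced rooted binary tree with 3 levels (7 nodes). An instance with parameter $k$ assigns to each of the 3 internal nodes $i$ a function $f_i:[k]^2\to[k]$ (given by its $k^2$ values) and to each of the 4 leaves an element of $[k]=\{1,\dots,k\}$; $v_i$ is the leaf label for a leaf and $v_i=f_i(\text{values of its two children})$ otherwise. $BT^3_2(k)$: decide whether the root value is $1$; its $k$-ary input variables are $f_i(a,b)$ and one per leaf. A deterministic $k$-way branching program computing $g:[k]^m\to R$ is a directed rooted multigraph of states; each nonfinal state is labelled by a variable index and has exactly $k$ outedges labelled $1,\dots,k$; $|R|$ final sink states are labelled by elements of $R$; on input $x$ the computation starts at the root, follows from a state labelled $j$ the edge labelled $x_j$, and must reach the final state labelled $g(x)$. Logarithms are base 2. -}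

module Defs where

open import Data.Nat using (ℕ; zero; suc; _≡ᵇ_)
open import Data.Fin using (Fin; zero; suc; toℕ)
open import Data.Bool using (Bool)
open import Data.Product using (Σ; _×_; ∃)
open import Data.Sum using (_⊎_; inj₁; inj₂)
open import Relation.Binary.PropositionalEquality using (_≡_)

-- Deterministic k-way branching programs
-- V : type of variable indices, k : domain size ([k] = Fin k),
-- R : set of results, n : number of states (states are Fin n).

data Node (V : Set) (k n : ℕ) (R : Set) : Set where
  query : V → (Fin k → Fin n) → Node V k n R
  final : R → Node V k n R

record BP (V : Set) (k : ℕ) (R : Set) (n : ℕ) : Set where
  field
    root : Fin n
    node : Fin n → Node V k n R
    final-unique : ∀ s s' r → node s ≡ final r → node s' ≡ final r → s ≡ s'
    final-exists : ∀ r → ∃ λ s → node s ≡ final r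

module _ {V : Set} {k : ℕ} {R : Set} {n : ℕ} (P : BP V k R n) where
  open BP P

  step : (V → Fin k) → Fin n → Fin n
  step x s with node s
  ... | query j next = next (x j)
  ... | final r      = s

  run : (V → Fin k) → ℕ → Fin n
  run x zero    = root
  run x (suc t) = step x (run x t)

  Computes : ((V → Fin k) → R) → Set
  Computes g = ∀ x → ∃ λ t → node (run x t) ≡ final (g x)

-- BT^3_2(k)
-- Internal nodes: Fin 3 (0 = root, 1 = left child, 2 = right child).
-- Leaves: Fin 4 (0,1 = children of node 1; 2,3 = children of node 2).
-- Variables: f_i(a,b) for i : Fin 3, a b : Fin k, and one per leaf.
-- The element 1 of [k] = {1,...,k} is represented by zero : Fin k.

BTVar : ℕ → Set
BTVar k = (Fin 3 × Fin k × Fin k) ⊎ Fin 4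

module _ {k : ℕ} (x : BTVar k → Fin k) where
  fn : Fin 3 → Fin k → Fin k → Fin k
  fn i a b = x (inj₁ (i Data.Product., a Data.Product., b))

  leaf : Fin 4 → Fin k
  leaf l = x (inj₂ l)

  rootValue : Fin k
  rootValue = fn zero (fn (suc zero) (leaf zero) (leaf (suc zero)))
                      (fn (suc (suc zero)) (leaf (suc (suc zero))) (leaf (suc (suc (suc zero)))))

BT : (k : ℕ) → (BTVar k → Fin k) → Bool
BT k x = toℕ (rootValue x) ≡ᵇ 0

{-# OPTIONS --safe #-}

-- Nečiporuk's method.  Fix the part of the input outside a set B of variables, and contract every
-- maximal run of states that do not query B.  The given program then computes the induced function
-- of B, and the contracted program is described by its start and by one target for each of the s
-- states querying B and each of the k edge labels; a target is one of these s states or a result.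
-- Hence at most (s + 2) ^ (1 + s k) functions of B are induced.
--
-- For a, b in [k] take B = {f₂(a,b), f₃(a,b)}.  Letting both pairs of leaves be (a,b), the table of
-- the root function induces all 2 ^ (k²) Boolean functions of B.  For k ≥ 256 this forces
-- 2 ^ k ≤ k ^ s, and multiplying over the k² disjoint sets B yields 2 ^ (k³) ≤ k ^ n.
module Submission where

open import Defs
open import Data.Bool using (Bool; true; false; if_then_else_)
open import Data.Empty using (⊥)
open import Data.Fin using (Fin; zero; suc; toℕ; combine; remQuot; join; splitAt; inject≤; finToFun; funToFin)
open import Data.Fin.Properties using (remQuot-combine; combine-remQuot; funToFin-finToFin; splitAt-join; injective⇒≤; toℕ-inject≤; 2↔Bool; suc-injective)
open import Data.List using (List; []; _∷_; length; filter; lookup; allFin)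
open import Data.List.Membership.Propositional.Properties using (∈-filter⁺; ∈-allFin)
open import Data.List.Properties using (length-tabulate)
open import Data.List.Relation.Unary.Any using (index)
open import Data.List.Relation.Unary.Any.Properties using (lookup-index)
open import Data.Maybe using (Maybe; just; nothing)
open import Data.Maybe.Properties using (≡-dec; just-injective)
open import Data.Nat using (ℕ; zero; suc; _+_; _*_; _⊔_; _^_; _≤_; _<_; z≤n; s≤s; _≡ᵇ_; _≤?_; NonZero; >-nonZero)
open import Data.Nat.Properties hiding (suc-injective)
open import Data.Product using (∃; _×_; _,_; proj₁; proj₂; uncurry)
open import Data.Sum using (_⊎_; inj₁; inj₂; map₂)
open import Data.Sum.Properties using (inj₁-injective; inj₂-injective)
open import Function using (_∘_; id; _↣_)
open import Function.Bundles using (Injection)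
open import Function.Definitions using (Injective)
open import Function.Properties.Inverse using (↔⇒↣; ↔-sym)
open import Relation.Binary.PropositionalEquality using (_≡_; refl; sym; trans; cong; cong₂; subst; _≗_)
open import Relation.Nullary using (¬_; yes; no; does; contradiction; ¬?)
open import Relation.Nullary.Decidable using (dec-true; dec-false)
open import Relation.Unary using (Pred; Decidable)
open import Level using (0ℓ)

-- Coding of finite functions and of disjoint unions.

finToFun-funToFin : ∀ {m n} (f : Fin m → Fin n) → finToFun (funToFin f) ≗ f
finToFun-funToFin f zero    = cong proj₁ (remQuot-combine (f zero) (funToFin (f ∘ suc)))
finToFun-funToFin f (suc i) = trans
  (cong (λ p → finToFun (proj₂ p) i) (remQuot-combine (f zero) (funToFin (f ∘ suc))))
  (finToFun-funToFin (f ∘ suc) i)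

funToFin-cong : ∀ {m n} {f g : Fin m → Fin n} → f ≗ g → funToFin f ≡ funToFin g
funToFin-cong {zero}  f≗g = refl
funToFin-cong {suc m} f≗g = cong₂ combine (f≗g zero) (funToFin-cong (f≗g ∘ suc))

finToFun-injective : ∀ {m n} {i j : Fin (n ^ m)} → finToFun {n} {m} i ≗ finToFun j → i ≡ j
finToFun-injective {m} {n} {i} {j} eq =
  trans (sym (funToFin-finToFin {m} {n} i)) (trans (funToFin-cong eq) (funToFin-finToFin {m} {n} j))

join-injective : ∀ m n → Injective _≡_ _≡_ (join m n)
join-injective m n {i} {j} eq =
  trans (sym (splitAt-join m n i)) (trans (cong (splitAt m) eq) (splitAt-join m n j))

map₂-injective : ∀ {A B C : Set} {f : B → C} → Injective _≡_ _≡_ f →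
                 Injective _≡_ _≡_ (map₂ {A = A} f)
map₂-injective inj {inj₁ _} {inj₁ _} eq = cong inj₁ (inj₁-injective eq)
map₂-injective inj {inj₂ _} {inj₂ _} eq = cong inj₂ (inj (inj₂-injective eq))

upperBound : ∀ {m} (f : Fin m → ℕ) → ∃ λ b → ∀ i → f i ≤ b
upperBound {zero}  f = 0 , λ ()
upperBound {suc m} f with upperBound (f ∘ suc)
... | b , f≤b = f zero ⊔ b , λ
  { zero    → m≤m⊔n (f zero) b
  ; (suc i) → ≤-trans (f≤b i) (m≤n⊔m (f zero) b) }

-- Counting over disjoint subsets of a list.

module _ {A : Set} {P : Pred A 0ℓ} (P? : Decidable P) where

  length-filter-¬ : ∀ xs → length (filter P? xs) + length (filter (¬? ∘ P?) xs) ≡ length xs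
  length-filter-¬ []       = refl
  length-filter-¬ (x ∷ xs) with P? x
  ... | yes _ = cong suc (length-filter-¬ xs)
  ... | no  _ = trans (+-suc _ _) (cong suc (length-filter-¬ xs))

  filter-disjoint : ∀ {Q : Pred A 0ℓ} (Q? : Decidable Q) → (∀ {x} → P x → ¬ Q x) →
                    ∀ xs → filter Q? (filter (¬? ∘ P?) xs) ≡ filter Q? xs
  filter-disjoint Q? P⇒¬Q []       = refl
  filter-disjoint Q? P⇒¬Q (x ∷ xs) with P? x
  ... | yes p rewrite dec-false (Q? x) (P⇒¬Q p) = filter-disjoint Q? P⇒¬Q xs
  ... | no  _ with does (Q? x)
  ...   | true  = cong (x ∷_) (filter-disjoint Q? P⇒¬Q xs)
  ...   | false = filter-disjoint Q? P⇒¬Q xs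

-- Disjointness keeps the sum of the filtered lengths within `length xs`. Induction on `m` splits
-- off the first sublist; by `filter-disjoint` the other sublists survive intact in the remainder.
product-over-disjoint :
  ∀ {A : Set} {m} {P : Fin m → Pred A 0ℓ} (P? : ∀ b → Decidable (P b)) →
  (∀ {b b′ x} → P b x → P b′ x → b ≡ b′) →
  ∀ c d .{{_ : NonZero d}} xs → (∀ b → c ≤ d ^ length (filter (P? b) xs)) →
  c ^ m ≤ d ^ length xs
product-over-disjoint {m = zero}  P? disj c d xs c≤ = m^n>0 d (length xs)
product-over-disjoint {m = suc m} P? disj c d xs c≤ = begin
  c * c ^ m                    ≤⟨ *-mono-≤ (c≤ zero) (product-over-disjoint (P? ∘ suc)
                                    (λ p q → suc-injective (disj p q)) c d rest c≤′) ⟩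
  d ^ length (filter (P? zero) xs) * d ^ length rest
                               ≡⟨ ^-distribˡ-+-* d (length (filter (P? zero) xs)) (length rest) ⟨
  d ^ (length (filter (P? zero) xs) + length rest)
                               ≡⟨ cong (d ^_) (length-filter-¬ (P? zero) xs) ⟩
  d ^ length xs                ∎
  where
  open ≤-Reasoning
  rest = filter (¬? ∘ P? zero) xs
  c≤′ : ∀ b → c ≤ d ^ length (filter (P? (suc b)) rest)
  c≤′ b = subst (λ ys → c ≤ d ^ length ys)
    (sym (filter-disjoint (P? zero) (P? (suc b)) (λ p q → contradiction (disj p q) λ ()) xs))
    (c≤ (suc b))

-- Nečiporuk's bound for one set of variables

module _ {V : Set} {k n : ℕ} {R : Set} where

  Asks : Pred V 0ℓ → Pred (Node V k n R) 0ℓ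
  Asks B (query j _) = B j
  Asks B (final _)   = ⊥

  asks? : ∀ {B} → Decidable B → Decidable (Asks B)
  asks? B? (query j _) = B? j
  asks? B? (final _)   = no λ ()

  -- Unlike in `step`, the edge label is given instead of read from an input, so a table entry
  -- exists for every label. The value at a final node is a filler: `table` follows only states that
  -- query `B`.
  follow : Node V k n R → Fin n → Fin k → Fin n
  follow (query _ next) s a = next a
  follow (final _)      s a = s

  query-injective : ∀ {j j′ : V} {next next′ : Fin k → Fin n} →
                    query {R = R} j next ≡ query j′ next′ → j ≡ j′
  query-injective refl = refl

override : ∀ {V C : Set} {B : Pred V 0ℓ} → Decidable B → (V → C) → (V → C) → V → C
override B? inside outside j = if does (B? j) then inside j else outside j

override-inside : ∀ {V C : Set} {B : Pred V 0ℓ} (B? : Decidable B) (f g : V → C) {j} →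
                  B j → override B? f g j ≡ f j
override-inside B? f g {j} b rewrite dec-true (B? j) b = refl

override-outside : ∀ {V C : Set} {B : Pred V 0ℓ} (B? : Decidable B) (f g : V → C) {j} →
                   ¬ B j → override B? f g j ≡ g j
override-outside B? f g {j} ¬b rewrite dec-false (B? j) ¬b = refl

module Subprogram {V : Set} {k n : ℕ} {R : Set} (P : BP V k R n)
                  {B : Pred V 0ℓ} (B? : Decidable B) where
  open BP P

  -- `run` adds steps at the end; the simulation recurses along the path from its front and needs
  -- the first step exposed.
  runFrom : (V → Fin k) → ℕ → Fin n → Fin n
  runFrom x zero    q = q
  runFrom x (suc t) q = runFrom x t (step P x q)

  step-runFrom : ∀ x t q → step P x (runFrom x t q) ≡ runFrom x t (step P x q)
  step-runFrom x zero    q = refl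
  step-runFrom x (suc t) q = step-runFrom x t (step P x q)

  run≡runFrom : ∀ x t → run P x t ≡ runFrom x t root
  run≡runFrom x zero    = refl
  run≡runFrom x (suc t) = trans (cong (step P x) (run≡runFrom x t)) (step-runFrom x t root)

  step-query : ∀ x {q j next} → node q ≡ query j next → step P x q ≡ next (x j)
  step-query x {q} eq with node q
  step-query x refl | query j next = refl

  runFrom-final : ∀ x t {q r} → node q ≡ final r → runFrom x t q ≡ q
  runFrom-final x zero    eq = refl
  runFrom-final x (suc t) {q} eq = trans (cong (runFrom x t) stay) (runFrom-final x t eq)
    where
    stay : step P x q ≡ q
    stay with node q
    stay | final _ = refl
    stay | query _ _ = contradiction eq λ ()

  queries? : Decidable (λ q → Asks B (node q))
  queries? q = asks? B? (node q)

  states : List (Fin n)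
  states = filter queries? (allFin n)

  size : ℕ
  size = length states

  data Class (q : Fin n) : Set where
    halts   : ∀ r → node q ≡ final r → Class q
    inside  : ∀ {j next} → node q ≡ query j next → B j →
              (i : Fin size) → q ≡ lookup states i → Class q
    outside : ∀ {j next} → node q ≡ query j next → ¬ B j → Class q

  classify : ∀ q → Class q
  classify q with node q in eq
  ... | final r      = halts r eq
  ... | query j next with B? j
  ...   | no ¬b = outside eq ¬b
  ...   | yes b = inside eq b (index q∈) (lookup-index q∈)
    where
    q∈ = ∈-filter⁺ queries? (∈-allFin q) (subst (Asks B) (sym eq) b)

  Target : Set
  Target = Fin size ⊎ R

  -- A loop avoiding B would never stop, hence the fuel; the junk result r₀ marks its exhaustion.
  module Contract (ρ : V → Fin k) (r₀ : R) where

    jump  : ℕ → Fin n → Target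
    jump′ : ℕ → ∀ {q} → Class q → Target

    jump t q = jump′ t (classify q)

    jump′ t       (halts r _)                          = inj₂ r
    jump′ t       (inside _ _ i _)                     = inj₁ i
    jump′ zero    (outside _ _)                        = inj₂ r₀
    jump′ (suc t) (outside {j = j} {next = next} _ _) = jump t (next (ρ j))

    table : ℕ → Fin size → Fin k → Target
    table t i a = jump t (follow (node (lookup states i)) (lookup states i) a)

  -- A relation rather than a function, because an arbitrary table may describe a program that
  -- loops. A derivation is a halting computation of the contracted program.
  data Leads (T : Fin size → Fin k → Target) (σ : V → Fin k) : Target → R → Set where
    stop : ∀ {r} → Leads T σ (inj₂ r) r
    go   : ∀ {i j next r} → node (lookup states i) ≡ query j next →
           Leads T σ (T i (σ j)) r → Leads T σ (inj₁ i) r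

  -- The variable queried at a state is fixed by `P`, so two computations from the same target read
  -- the same value of `σ` and, the tables agreeing, move to the same target.
  leads-deterministic : ∀ {T T′ σ c r r′} → (∀ i a → T i a ≡ T′ i a) →
                        Leads T σ c r → Leads T′ σ c r′ → r ≡ r′
  leads-deterministic T≡T′ stop       stop         = refl
  leads-deterministic {T′ = T′} {σ} {r′ = r′} T≡T′ (go {i} {j} eq l) (go eq′ l′)
    with refl ← query-injective (trans (sym eq) eq′) =
    leads-deterministic T≡T′ l (subst (λ c → Leads T′ σ c r′) (sym (T≡T′ i (σ j))) l′)

  module _ (ρ σ : V → Fin k) (r₀ : R) where
    open Contract ρ r₀

    private x = override B? σ ρ

    -- The fuel t′ of the current jump is used up in step with the run, whereas every later jump
    -- starts with the full fuel u.
    simulate : ∀ {u} t t′ → t ≤ t′ → t′ ≤ u → ∀ q {r} → node (runFrom x t q) ≡ final r →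
               Leads (table u) σ (jump t′ q) r
    simulate {u} t t′ t≤t′ t′≤u q {r} fin with classify q
    ... | halts r′ eq with refl ← trans (sym eq) (trans (cong node (sym (runFrom-final x t eq))) fin) = stop
    simulate zero    t′ t≤t′ t′≤u q fin | inside eq b i q≡ = contradiction (trans (sym eq) fin) λ ()
    simulate {u} (suc t) t′ t≤t′ t′≤u q {r} fin | inside {j} {next} eq b i q≡ =
      go eqᵢ (subst (λ s → Leads (table u) σ (jump u s) r) s≡
        (simulate t u (≤-trans (n≤1+n t) (≤-trans t≤t′ t′≤u)) ≤-refl (step P x q) fin))
      where
      eqᵢ : node (lookup states i) ≡ query j next
      eqᵢ = trans (cong node (sym q≡)) eq
      s≡ : step P x q ≡ follow (node (lookup states i)) (lookup states i) (σ j)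
      s≡ = trans (step-query x eq) (trans (cong next (override-inside B? σ ρ b))
             (sym (cong (λ nd → follow nd (lookup states i) (σ j)) eqᵢ)))
    simulate zero    t′ t≤t′ t′≤u q fin | outside eq ¬b = contradiction (trans (sym eq) fin) λ ()
    -- The fuel covers the `suc t` steps left to the run, so it is not 0 and `r₀` is not produced
    -- here.
    simulate {u} (suc t) (suc t′) (s≤s t≤t′) t′<u q {r} fin | outside {j} {next} eq ¬b =
      simulate t t′ t≤t′ (≤-trans (n≤1+n t′) t′<u) (next (ρ j))
        (subst (λ s → node (runFrom x t s) ≡ final r)
          (trans (step-query x eq) (cong next (override-outside B? σ ρ ¬b))) fin)

  module _ {g : (V → Fin k) → R} (P-computes : Computes P g) {r : ℕ} (R↣r : R ↣ Fin r)
           {M N : ℕ} (σ : Fin M → V → Fin k) (ρ : Fin N → V → Fin k)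
           (distinct : ∀ {i i′} →
             (∀ y → g (override B? (σ y) (ρ i)) ≡ g (override B? (σ y) (ρ i′))) → i ≡ i′) where

    private
      time : Fin N → Fin M → ℕ
      time i y = proj₁ (P-computes (override B? (σ y) (ρ i)))

      -- The description of `ρ i` must not vary with the assignment to `B`, so one fuel has to cover
      -- all `M` runs.
      fuel : Fin N → ℕ
      fuel i = proj₁ (upperBound (time i))

      start : Fin N → Target
      -- Any element of `R` would do as the junk result; `g (ρ i)` is one at hand.
      start i = Contract.jump (ρ i) (g (ρ i)) (fuel i) root

      tables : Fin N → Fin size → Fin k → Target
      tables i = Contract.table (ρ i) (g (ρ i)) (fuel i)

      leads : ∀ i y → Leads (tables i) (σ y) (start i) (g (override B? (σ y) (ρ i)))
      leads i y = simulate (ρ i) (σ y) (g (ρ i)) (time i y) (fuel i)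
        (proj₂ (upperBound (time i)) y) ≤-refl root
        (subst (λ s → node s ≡ final (g (override B? (σ y) (ρ i))))
          (run≡runFrom (override B? (σ y) (ρ i)) (time i y))
          (proj₂ (P-computes (override B? (σ y) (ρ i)))))

      encode : Target → Fin (size + r)
      encode c = join size r (map₂ (Injection.to R↣r) c)

      encode-injective : ∀ {c c′} → encode c ≡ encode c′ → c ≡ c′
      encode-injective eq = map₂-injective (Injection.injective R↣r) (join-injective size r eq)

      description : Fin N → Fin (suc (size * k)) → Fin (size + r)
      description i zero    = encode (start i)
      description i (suc p) = encode (uncurry (tables i) (remQuot k p))

      code : Fin N → Fin ((size + r) ^ suc (size * k))
      code i = funToFin (description i)

      code-injective : Injective _≡_ _≡_ code
      code-injective {i} {i′} eq = distinct λ y →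
        leads-deterministic tables≡ (leads i y)
          (subst (λ c → Leads (tables i′) (σ y) c _) (sym (encode-injective (description≡ zero))) (leads i′ y))
        where
        description≡ : description i ≗ description i′
        description≡ p = trans (sym (finToFun-funToFin (description i) p))
          (trans (cong (λ c → finToFun c p) eq) (finToFun-funToFin (description i′) p))

        tables≡ : ∀ s a → tables i s a ≡ tables i′ s a
        tables≡ s a = subst (λ sa → uncurry (tables i) sa ≡ uncurry (tables i′) sa)
          (remQuot-combine s a) (encode-injective (description≡ (suc (combine s a))))

    nečiporuk : N ≤ (size + r) ^ suc (size * k)
    nečiporuk = injective⇒≤ code-injective

-- Subfunctions of BT

module _ {k : ℕ} where

  -- The sets `B` are the fibres over `just c`, hence disjoint by construction.
  block : BTVar k → Maybe (Fin (k * k))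
  block (inj₁ (zero  , a , b)) = nothing
  block (inj₁ (suc _ , a , b)) = just (combine a b)
  block (inj₂ _)               = nothing

  inBlock? : ∀ c → Decidable (λ j → block j ≡ just c)
  inBlock? c j = ≡-dec Data.Fin._≟_ (block j) (just c)

  children : Fin k × Fin k → BTVar k → Fin k
  children (u , v) (inj₁ (suc zero , _)) = u
  children (u , v) _                     = v

  -- `F` is meant as the table of the root. The child functions receive it too, but off the block
  -- their values do not affect the root value.
  surroundings : 2 ≤ k → Fin k × Fin k → (Fin (k * k) → Fin 2) → BTVar k → Fin k
  surroundings 2≤k _       F (inj₁ (_ , u , v))       = inject≤ (F (combine u v)) 2≤k
  surroundings 2≤k (a , b) F (inj₂ zero)              = a
  surroundings 2≤k (a , b) F (inj₂ (suc zero))        = b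
  surroundings 2≤k (a , b) F (inj₂ (suc (suc zero)))  = a
  surroundings 2≤k (a , b) F (inj₂ (suc (suc (suc _)))) = b

  module _ (2≤k : 2 ≤ k) (c : Fin (k * k)) where

    instanceOf : Fin (k * k) → Fin (2 ^ (k * k)) → BTVar k → Fin k
    instanceOf y F = override (inBlock? c) (children (remQuot k y))
                       (surroundings 2≤k (remQuot k c) (finToFun F))

    -- The leaves send both children to the entries of block `c`, which hold the two parts of `y`;
    -- the root table is then read at `y`.
    BT-instanceOf : ∀ y F → BT k (instanceOf y F) ≡ (toℕ (finToFun {2} {k * k} F y) ≡ᵇ 0)
    BT-instanceOf y F = cong (_≡ᵇ 0) (begin-equality
      toℕ (rootValue (instanceOf y F))
        ≡⟨ cong₂ (λ u v → toℕ (inject≤ (f (combine u v)) 2≤k)) (child≡ zero) (child≡ (suc zero)) ⟩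
      toℕ (inject≤ (f (uncurry combine (remQuot {k} k y))) 2≤k)
        ≡⟨ toℕ-inject≤ (f (uncurry combine (remQuot {k} k y))) 2≤k ⟩
      toℕ (f (uncurry combine (remQuot {k} k y)))
        ≡⟨ cong (toℕ ∘ f) (combine-remQuot {k} k y) ⟩
      toℕ (f y) ∎)
      where
      open ≤-Reasoning
      f : Fin (k * k) → Fin 2
      f = finToFun F
      child≡ : ∀ i → let j = inj₁ (suc i , remQuot k c) in
               instanceOf y F j ≡ children (remQuot k y) j
      child≡ i = override-inside (inBlock? c) (children (remQuot k y))
        (surroundings 2≤k (remQuot k c) f) {inj₁ (suc i , remQuot k c)}
        (cong just (combine-remQuot {k} k c))

    -- The answer only tells whether a table entry is 0, which determines an element of `Fin 2`.
    instanceOf-distinct : ∀ {F F′} →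
      (∀ y → BT k (instanceOf y F) ≡ BT k (instanceOf y F′)) → F ≡ F′
    instanceOf-distinct {F} {F′} eq = finToFun-injective {k * k} {2} λ y →
      ≡ᵇ0-injective _ _ (trans (sym (BT-instanceOf y F)) (trans (eq y) (BT-instanceOf y F′)))
      where
      ≡ᵇ0-injective : ∀ (p q : Fin 2) → (toℕ p ≡ᵇ 0) ≡ (toℕ q ≡ᵇ 0) → p ≡ q
      ≡ᵇ0-injective zero       zero       _ = refl
      ≡ᵇ0-injective (suc zero) (suc zero) _ = refl

    BT-subprogram-size : ∀ {n} (P : BP (BTVar k) k Bool n) → Computes P (BT k) →
      let s = Subprogram.size P (inBlock? c) in 2 ^ (k * k) ≤ (s + 2) ^ suc (s * k)
    BT-subprogram-size P P-computes =
      Subprogram.nečiporuk P (inBlock? c) P-computes (↔⇒↣ (↔-sym 2↔Bool))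
        (children ∘ remQuot k) (surroundings 2≤k (remQuot k c) ∘ finToFun) instanceOf-distinct

-- Inequalities between powers.

^-distribʳ-* : ∀ m n o → (m * n) ^ o ≡ m ^ o * n ^ o
^-distribʳ-* m n zero    = refl
^-distribʳ-* m n (suc o) = trans (cong (m * n *_) (^-distribʳ-* m n o)) ([m*n]*[o*p]≡[m*o]*[n*p] m n (m ^ o) (n ^ o))

n≤2^n : ∀ n → n ≤ 2 ^ n
n≤2^n zero    = z≤n
n≤2^n (suc n) = ≤-trans (+-mono-≤ (m^n>0 2 n) (n≤2^n n)) (≤-reflexive (cong (2 ^ n +_) (sym (+-identityʳ _))))

^-cancelʳ-< : ∀ m .{{_ : NonZero m}} {n o} → m ^ n < m ^ o → n < o
^-cancelʳ-< m {n} {o} m^n<m^o with o ≤? n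
... | yes o≤n = contradiction m^n<m^o (≤⇒≯ (^-monoʳ-≤ m o≤n))
... | no  o≰n = ≰⇒> o≰n

-- If `k ^ s < 2 ^ k`, then `s` is so small that `s + 2` is at most half of `k`. This slack absorbs
-- the successor in the exponent, and `(k ^ s) ^ k < 2 ^ (k * k)` contradicts the hypothesis.
size-bound : ∀ k s → 256 ≤ k → 2 ^ (k * k) ≤ (s + 2) ^ suc (s * k) → 2 ^ k ≤ k ^ s
-- Here `h` reads `2 ^ (k * k) ≤ 2 ^ 1`.
size-bound k zero 256≤k h = contradiction h (<⇒≱ (^-monoʳ-< 2 ≤-refl 1<k*k))
  where
  1<k : 1 < k
  1<k = ≤-trans (m≤m+n 2 254) 256≤k
  1<k*k : 1 < k * k
  1<k*k = *-mono-< 1<k 1<k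
size-bound k s@(suc _) 256≤k h with 2 ^ k ≤? k ^ s
... | yes p = p
... | no ¬p = contradiction contra (<-irrefl refl)
  where
  open ≤-Reasoning
  instance
    k≢0 : NonZero k
    k≢0 = >-nonZero (≤-trans (m≤m+n 1 255) 256≤k)

  -- As 256 is `2 ^ 8`, the negated goal becomes a linear bound on `s`.
  8s<k : 8 * s < k
  8s<k = ^-cancelʳ-< 2 (begin-strict
    2 ^ (8 * s)  ≡⟨ ^-*-assoc 2 8 s ⟨
    256 ^ s      ≤⟨ ^-monoˡ-≤ s 256≤k ⟩
    k ^ s        <⟨ ≰⇒> ¬p ⟩
    2 ^ k        ∎)

  2[s+2]≤k : (s + 2) * 2 ≤ k
  2[s+2]≤k = *-cancelˡ-≤ 2 (begin
    2 * ((s + 2) * 2) ≡⟨ cong (2 *_) (*-comm (s + 2) 2) ⟩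
    2 * (2 * (s + 2)) ≡⟨ *-assoc 2 2 (s + 2) ⟨
    4 * (s + 2)       ≡⟨ *-distribˡ-+ 4 s 2 ⟩
    4 * s + 8         ≤⟨ +-mono-≤ (≤-trans (*-monoˡ-≤ s (m≤m+n 4 4)) (<⇒≤ 8s<k)) (≤-trans (m≤m+n 8 248) 256≤k) ⟩
    k + k             ≡⟨ cong (k +_) (+-identityʳ k) ⟨
    2 * k             ∎)

  e = s * k

  [s+2]^≤ : (s + 2) ^ suc e ≤ k ^ e
  -- Doubling the base costs `2 ^ suc e` and keeps it at most `k`. The one surplus factor `k` is at
  -- most `2 ^ k`, and `k ≤ suc e` because `s` is positive.
  [s+2]^≤ = *-cancelʳ-≤ _ _ (2 ^ suc e) {{m^n≢0 2 (suc e)}} (begin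
    (s + 2) ^ suc e * 2 ^ suc e ≡⟨ ^-distribʳ-* (s + 2) 2 (suc e) ⟨
    ((s + 2) * 2) ^ suc e       ≤⟨ ^-monoˡ-≤ (suc e) 2[s+2]≤k ⟩
    k * k ^ e                   ≡⟨ *-comm k (k ^ e) ⟩
    k ^ e * k                   ≤⟨ *-monoʳ-≤ (k ^ e) (n≤2^n k) ⟩
    k ^ e * 2 ^ k               ≤⟨ *-monoʳ-≤ (k ^ e) (^-monoʳ-≤ 2 (≤-trans (m≤n*m k s) (n≤1+n e))) ⟩
    k ^ e * 2 ^ suc e           ∎)

  contra : 2 ^ (k * k) < 2 ^ (k * k)
  contra = begin-strict
    2 ^ (k * k)     ≤⟨ h ⟩
    (s + 2) ^ suc e ≤⟨ [s+2]^≤ ⟩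
    k ^ e           ≡⟨ ^-*-assoc k s k ⟨
    (k ^ s) ^ k     <⟨ ^-monoˡ-< k (≰⇒> ¬p) ⟩
    (2 ^ k) ^ k     ≡⟨ ^-*-assoc 2 k k ⟩
    2 ^ (k * k)     ∎

-- Taking logarithms of the conclusion gives `k ^ 3 ≤ n log k`; the power form avoids real numbers.
theorem5p7 : ∃ λ K → ∀ k → K ≤ k → ∀ n (P : BP (BTVar k) k Bool n) →
    Computes P (BT k) → 2 ^ (k ^ 3) ≤ k ^ n
theorem5p7 = 256 , λ k 256≤k n P P-computes →
  let open ≤-Reasoning
      2≤k = ≤-trans (m≤m+n 2 254) 256≤k
      node = BP.node P
  in begin
    2 ^ (k ^ 3)              ≡⟨ cong (λ m → 2 ^ (k * (k * m))) (*-identityʳ k) ⟩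
    2 ^ (k * (k * k))        ≡⟨ ^-*-assoc 2 k (k * k) ⟨
    (2 ^ k) ^ (k * k)        ≤⟨ product-over-disjoint
                                  (λ c → Subprogram.queries? P (inBlock? c))
                                  (λ {_} {_} {q} → asks-unique (node q))
                                  (2 ^ k) k {{>-nonZero (≤-trans (n≤1+n 1) 2≤k)}} (allFin n)
                                  (λ c → size-bound k (Subprogram.size P (inBlock? c)) 256≤k (BT-subprogram-size 2≤k c P P-computes)) ⟩
    k ^ length (allFin n)    ≡⟨ cong (k ^_) (length-tabulate {n = n} id) ⟩
    k ^ n                    ∎
  where
  -- A state queries one variable, so it is counted for at most one block.
  asks-unique : ∀ {k n b b′} (nd : Node (BTVar k) k n Bool) →
                Asks (λ j → block j ≡ just b) nd → Asks (λ j → block j ≡ just b′) nd → b ≡ b′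
  asks-unique (query j _) p q = just-injective (trans (sym p) q)
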